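{- Let $p$ and $q$ be two different odd primes and let $a\in(\mathbb{Z}/pq\mathbb{Z})^*$ be such that $a\bmod p$ generates $(\mathbb{Z}/p\mathbb{Z})^*$ and $a^{(p-1)/2}\equiv-1\pmod{pq}$. Let $S=S_{pq}(a)$ and $\lambda=|S\cap(S+1)|$. If $\lambda\equiv-2\pmod q$, then with $t=(\lambda+2)/q$ and any permutations $\pi_2,\dots,\pi_t$ of $\{1,\dots,p\}$, the graph $F_{(\pi_2,\dots,\pi_t)}(\Gamma_{pq}(a))$ is a Neumaier graph with parameters $(tpq,\,p+\lambda,\,\lambda;\,1,\,\lambda+2)$.
   Context: $S_{pq}(a)=\{a^j: 0\le j<p-1\}\subseteq\mathbb{Z}/pq\mathbb{Z}$, and $\Gamma_{pq}(a)$ is the Cayley graph on $(\mathbb{Z}/pq\mathbb{Z},+)$ with connection set $S_{pq}(a)$ ($x\sim y$ iff $x-y\in S_{pq}(a)$); $S+1=\{s+1:s\in S\}$. Its vertex set is partitioned into the $p$ cosets $C_1,\dots,C_p$ (in some fixed order) of the additive subgroup generated by $p$. Construction $F$: take $t$ disjoint copies $\Gamma_1,\dots,\Gamma_t$ of $\Gamma_{pq}(a)$, with $C_{i,r}$ the copy of $C_r$ in $\Gamma_i$, and set $\pi_1=\mathrm{id}$; $F_{(\pi_2,\dots,\pi_t)}(\Gamma_{pq}(a))$ has vertex set the union of the copies, and distinct $x\in C_{i,k'}$, $y\in C_{j,l'}$ are adjacent iff ($i=j$ and $x\sim y$ in $\Gamma_i$) or $\pi_i^{ -1}(k')=\pi_j^{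 -1}(l')$. A regular graph is $\lambda$-edge-regular if it has at least one edge and any two adjacent vertices have exactly $\lambda$ common neighbours. A Neumaier graph with parameters $(v,k,\lambda;e,s)$ is a non-complete $k$-regular, $\lambda$-edge-regular graph on $v$ vertices containing a clique of size $s$ such that every vertex outside it has exactly $e>0$ neighbours in it. -}

module Defs where

open import Level using (0ℓ)
open import Algebra.Bundles.Raw using (RawMonoid; RawRing)
import Algebra.Definitions as Definitions
import Algebra.Definitions.RawMonoid as RawMonoidDefs
import Algebra.Definitions.RawSemiring as RawSemiringDefs
open import Data.Fin.Base using (Fin; zero; suc; toℕ)
open import Data.Fin.Permutation using (Permutation′; _⟨$⟩ˡ_; id)
open import Data.Fin.Properties using (any?; _≟_)
open import Data.Integer.Base as ℤ using (ℤ)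
import Data.Integer.Divisibility as ℤ
open import Data.List.Base using (List; length; filter; allFin)
open import Data.List.Membership.Propositional using (_∈_)
open import Data.List.Relation.Unary.Unique.Propositional using (Unique)
open import Data.Nat.Base using (ℕ; zero; suc; NonZero; _<_; _∸_)
import Data.Nat.Base as ℕ
open import Data.Nat.DivMod using (_mod_)
open import Data.Nat.Properties using (anyUpTo?; m*n≢0)
open import Data.Product.Base using (∃; ∃₂; _×_; _,_)
open import Data.Sum.Base using (_⊎_)
open import Function.Bundles using (_⇔_)
open import Relation.Binary.Core using (Rel)
open import Relation.Binary.Definitions using (Symmetric; Irreflexive)
open import Relation.Binary.PropositionalEquality.Core using (_≡_; _≢_)
open import Relation.Nullary using (¬_)
open import Relation.Nullary.Decidable using (_×-dec_)
open import Relation.Unary using (Pred; Decidable; U; _∩_; _≐_)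
import Relation.Unary.Properties as Unary

------------------------------------------------------------------------
-- Cardinalities

-- The existence of a duplicate-free listing does not depend on whether P
-- is proof-irrelevant, unlike a bijection between Fin k and ∃ P.
HasCard : {A : Set} → Pred A 0ℓ → ℕ → Set
HasCard {A} P k =
  ∃ λ (xs : List A) → Unique xs × length xs ≡ k × (∀ x → x ∈ xs ⇔ P x)

count : ∀ {n} {P : Pred (Fin n) 0ℓ} → Decidable P → ℕ
count {n} P? = length (filter P? (allFin n))

------------------------------------------------------------------------
-- Modular arithmetic

_≡_[mod_] : ℤ → ℤ → ℕ → Set
x ≡ y [mod n ] = (ℤ.+ n) ℤ.∣ (x ℤ.- y)

ℤ/_ : (n : ℕ) .{{_ : NonZero n}} → RawRing 0ℓ 0ℓ
ℤ/ n = record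
  { Carrier = Fin n
  ; _≈_     = _≡_
  ; _+_     = λ x y → (toℕ x ℕ.+ toℕ y) mod n
  ; _*_     = λ x y → (toℕ x ℕ.* toℕ y) mod n
  ; -_      = λ x → (n ∸ toℕ x) mod n
  ; 0#      = 0 mod n
  ; 1#      = 1 mod n
  }

-- All integer powers of g: a negative power g⁻ⁿ is the x with x ∙ gⁿ ≈ ε.
Cyclic : (M : RawMonoid 0ℓ 0ℓ) (g : RawMonoid.Carrier M) →
         Pred (RawMonoid.Carrier M) 0ℓ
Cyclic M g x = ∃ λ (n : ℕ) → (x ≈ n ⋆ g) ⊎ (x ∙ (n ⋆ g) ≈ ε)
  where
  open RawMonoid M
  open RawMonoidDefs M using () renaming (_×_ to _⋆_)

IsUnit : (R : RawRing 0ℓ 0ℓ) → Pred (RawRing.Carrier R) 0ℓ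
IsUnit R = Definitions.Invertible _≈_ 1# _*_
  where open RawRing R

GeneratesUnits : (R : RawRing 0ℓ 0ℓ) → Pred (RawRing.Carrier R) 0ℓ
GeneratesUnits R g = IsUnit R g × (∀ u → IsUnit R u → Cyclic *-rawMonoid g u)
  where open RawRing R

------------------------------------------------------------------------
-- Graphs, given by a vertex type and an adjacency relation

module _ {V : Set} (_~_ : Rel V 0ℓ) where

  IsSimple : Set
  IsSimple = Symmetric _~_ × Irreflexive _≡_ _~_

  IsComplete : Set
  IsComplete = ∀ x y → x ≢ y → x ~ y

  IsRegular : ℕ → Set
  IsRegular k = ∀ x → HasCard (λ y → x ~ y) k

  IsEdgeRegular : ℕ → Set
  IsEdgeRegular l =
    (∃₂ λ x y → x ~ y) ×
    (∀ x y → x ~ y → HasCard (λ z → (x ~ z) × (y ~ z)) l)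

  IsClique : Pred V 0ℓ → Set
  IsClique K = ∀ x y → K x → K y → x ≢ y → x ~ y

  record IsNeumaier (v k l e s : ℕ) : Set₁ where
    field
      simple      : IsSimple
      order       : HasCard {V} U v
      nonComplete : ¬ IsComplete
      regular     : IsRegular k
      edgeRegular : IsEdgeRegular l
      e>0         : 0 < e
      K           : Pred V 0ℓ
      K-clique    : IsClique K
      K-size      : HasCard K s
      K-regular   : ∀ x → ¬ K x → HasCard (λ y → K y × (x ~ y)) e

------------------------------------------------------------------------
-- The Cayley graph Γ_pq(a) and the construction F

module _ (p q : ℕ) .{{_ : NonZero p}} .{{_ : NonZero q}} where

  ℤ/pq : RawRing 0ℓ 0ℓ
  ℤ/pq = ℤ/_ (p ℕ.* q) {{m*n≢0 p q}}

  open RawRing ℤ/pq using (_+_; -_; 1#; +-rawMonoid; rawSemiring)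
  open RawSemiringDefs rawSemiring using (_^_)

  S : Fin (p ℕ.* q) → Pred (Fin (p ℕ.* q)) 0ℓ
  S a x = ∃ λ j → j < p ∸ 1 × x ≡ a ^ j

  S? : ∀ a → Decidable (S a)
  S? a x = anyUpTo? (λ j → x ≟ a ^ j) (p ∸ 1)

  S+1 : Fin (p ℕ.* q) → Pred (Fin (p ℕ.* q)) 0ℓ
  S+1 a x = ∃ λ s → S a s × x ≡ s + 1#

  S+1? : ∀ a → Decidable (S+1 a)
  S+1? a x = any? λ s → S? a s ×-dec (x ≟ s + 1#)

  ∣S∩S+1∣ : Fin (p ℕ.* q) → ℕ
  ∣S∩S+1∣ a = count {P = S a ∩ S+1 a} (S? a Unary.∩? S+1? a)

  Γ : Fin (p ℕ.* q) → Rel (Fin (p ℕ.* q)) 0ℓ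
  Γ a x y = S a (x + (- y))

  ⟨p⟩ : Pred (Fin (p ℕ.* q)) 0ℓ
  ⟨p⟩ = Cyclic +-rawMonoid (_mod_ p (p ℕ.* q) {{m*n≢0 p q}})

  coset : Fin (p ℕ.* q) → Pred (Fin (p ℕ.* q)) 0ℓ
  coset g x = ⟨p⟩ (x + (- g))

  -- C lists every coset of ⟨p⟩ exactly once; the order is arbitrary.
  record IsCosetListing (C : Fin p → Pred (Fin (p ℕ.* q)) 0ℓ) : Set where
    field
      isCoset   : ∀ r → ∃ λ g → C r ≐ coset g
      exhausts  : ∀ g → ∃ λ r → C r ≐ coset g
      injective : ∀ r r′ → C r ≐ C r′ → r ≡ r′

  -- Extends (π₂, …, π_t) by π₁ = id; copy number 1 has index zero in Fin t.
  withId : ∀ {t} → (Fin (t ∸ 1) → Permutation′ p) → Fin t → Permutation′ p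
  withId {suc t} π zero    = id
  withId {suc t} π (suc i) = π i

  -- The vertex (i , x) is the copy of x in Γᵢ.
  F : ∀ {t} → (Fin p → Pred (Fin (p ℕ.* q)) 0ℓ) →
      (Fin (t ∸ 1) → Permutation′ p) → Fin (p ℕ.* q) →
      Rel (Fin t × Fin (p ℕ.* q)) 0ℓ
  F C π a (i , x) (j , y) =
    (i , x) ≢ (j , y) ×
    ((i ≡ j × Γ a x y) ⊎
     ∃₂ λ k l → C k x × C l y × withId π i ⟨$⟩ˡ k ≡ withId π j ⟨$⟩ˡ l)

{-# OPTIONS --safe #-}

-- Since a^((p-1)/2) = -1, S is closed under products, inverses and negation; since a
-- generates (ℤ/p)ˣ, reduction mod p maps S bijectively onto the p - 1 nonzero residues.
-- Hence Γ is edge-regular and consists of perfect matchings between the cosets of ⟨p⟩.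
-- F glues the cosets of t copies of Γ into p cliques of size tq = λ + 2, and between any
-- two of these cliques F again has just a perfect matching.  Two clique-mates thus have
-- only the other λ clique-mates as common neighbours, while two vertices of different
-- cliques acquire no common neighbours beyond those in Γ.

module Submission where

open import Defs
open import Level using (0ℓ)
open import Algebra.Bundles using (CommutativeRing)
open import Algebra.Bundles.Raw using (module RawRing)
open import Algebra.Definitions.RawSemiring using (_^_)
import Algebra.Properties.AbelianGroup as AbelianGroupProperties
import Algebra.Properties.Group as GroupProperties
import Algebra.Properties.Monoid.Mult as Mult
import Algebra.Properties.Ring as RingProperties
import Algebra.Properties.Semiring.Exp as Exp
open import Data.Fin.Base using (Fin; suc; toℕ; fromℕ<; cast; combine; remQuot; punchOut)
open import Data.Fin.Permutation using (Permutation′; _⟨$⟩ˡ_; _⟨$⟩ʳ_; inverseˡ; inverseʳ)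
import Data.Fin.Properties as Fin
open import Data.Integer.Base using (+_; -_)
open import Data.List.Base using ([]; _∷_; _++_; map; filter; allFin)
import Data.List.Properties as List
open import Data.List.Membership.Propositional.Properties
  using (∈-map⁺; ∈-map⁻; ∈-++⁺ˡ; ∈-++⁺ʳ; ∈-++⁻; ∈-∃++; ∈-filter⁺; ∈-filter⁻; ∈-allFin)
open import Data.List.Relation.Binary.Permutation.Propositional using (↭-sym; ↭⇒↭ₛ)
open import Data.List.Relation.Binary.Permutation.Propositional.Properties
  using (shift; ∈-resp-↭; ↭-length)
import Data.List.Relation.Binary.Permutation.Setoid.Properties as Permutationₛ
open import Data.List.Relation.Unary.All as All using ([])
open import Data.List.Relation.Unary.AllPairs using ([]; _∷_)
open import Data.List.Relation.Unary.Any as Any using (here; there)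
import Data.List.Relation.Unary.Unique.Propositional.Properties as Unique
open import Data.Nat.Base using (ℕ; zero; suc; NonZero; _+_; _*_; _∸_; _/_; _%_; _<_; s≤s; z≤n)
import Data.Nat.Base as ℕ
open import Data.Nat.Coprimality using (prime⇒coprime; coprime-Bézout)
open import Data.Nat.Divisibility using (_∣_; divides; m∣m*n; m%n≡0⇒n∣m)
open import Data.Nat.DivMod using (_mod_)
import Data.Nat.DivMod as ℕ
open import Data.Nat.GCD using (module Bézout)
open import Data.Nat.Primality using (Prime; prime⇒nonTrivial)
import Data.Nat.Properties as ℕ
open import Data.Product.Base using (∃; ∃₂; _×_; _,_; proj₁; proj₂; uncurry)
open import Data.Product.Properties using (,-injectiveˡ; ,-injectiveʳ)
open import Data.Sum.Base as Sum using (_⊎_; inj₁; inj₂)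
open import Data.Unit.Base using (tt)
open import Function.Base using (_∘_; _∋_)
open import Function.Bundles using (_⇔_; mk⇔; Equivalence)
open import Function.Definitions using (Injective)
open import Relation.Binary.Core using (Rel)
open import Relation.Binary.PropositionalEquality using
  ( _≡_; _≢_; refl; sym; trans; cong; cong₂; subst; subst₂
  ; setoid; isEquivalence; module ≡-Reasoning )
open import Relation.Nullary using (¬_; yes; no; contradiction)
open import Relation.Unary using (Pred; Decidable; U; _∪_)

open Equivalence using (to; from)

private variable
  A B : Set
  k m n : ℕ

-- Finite cardinalities

hasCard-⇔ : {P Q : Pred A 0ℓ} → (∀ x → P x ⇔ Q x) → HasCard P k → HasCard Q k
hasCard-⇔ P⇔Q (xs , uniq , len , mem) =
  xs , uniq , len , λ x → mk⇔ (to (P⇔Q x) ∘ to (mem x)) (from (mem x) ∘ from (P⇔Q x))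

hasCard-map : {P : Pred A 0ℓ} (f : A → B) → Injective _≡_ _≡_ f → HasCard P k →
              HasCard (λ y → ∃ λ x → P x × y ≡ f x) k
hasCard-map f inj (xs , uniq , len , mem) =
  map f xs , Unique.map⁺ inj uniq , trans (List.length-map f xs) len , λ y → mk⇔
    (λ y∈ → let x , x∈ , y≡ = ∈-map⁻ f y∈ in x , to (mem x) x∈ , y≡)
    (λ { (x , Px , refl) → ∈-map⁺ f (from (mem x) Px) })

hasCard-∪ : {P Q : Pred A 0ℓ} → (∀ {x} → P x → ¬ Q x) →
            HasCard P m → HasCard Q n → HasCard (P ∪ Q) (m + n)
hasCard-∪ disj (xs , uxs , lxs , mxs) (ys , uys , lys , mys) =
  xs ++ ys ,
  Unique.++⁺ uxs uys (λ (x∈ , y∈) → disj (to (mxs _) x∈) (to (mys _) y∈)) ,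
  trans (List.length-++ xs) (cong₂ _+_ lxs lys) ,
  λ z → mk⇔
    (λ z∈ → Sum.map (to (mxs z)) (to (mys z)) (∈-++⁻ xs z∈))
    Sum.[ ∈-++⁺ˡ ∘ from (mxs z) , ∈-++⁺ʳ xs ∘ from (mys z) ]

-- The listing is split at `x` and `x` is moved to the front. Uniqueness survives this permutation,
-- so `x` does not occur in the remaining list.
hasCard-remove : {P : Pred A 0ℓ} {x : A} → P x → HasCard P (suc k) →
                 HasCard (λ y → P y × y ≢ x) k
hasCard-remove {A = A} {x = x} Px (xs , uniq , len , mem)
  with ys , zs , refl ← ∈-∃++ (from (mem x) Px)
  with x≢ ∷ uniq′ ← Permutationₛ.Unique-resp-↭ (setoid A) (↭⇒↭ₛ (shift x ys zs)) uniq
  = ys ++ zs , uniq′ , ℕ.suc-injective (trans (sym (↭-length (shift x ys zs))) len) , λ y → mk⇔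
    (λ y∈ → to (mem y) (∈-resp-↭ (↭-sym (shift x ys zs)) (there y∈)) , All.lookup x≢ y∈ ∘ sym)
    (λ (Py , y≢x) → Any.tail y≢x (∈-resp-↭ (shift x ys zs) (from (mem y) Py)))

hasCard-inhabited : {P : Pred A 0ℓ} → HasCard P (suc k) → ∃ P
hasCard-inhabited (x ∷ xs , _ , _ , mem) = x , to (mem x) (here refl)

hasCard-singleton : (x : A) → HasCard (_≡ x) 1
hasCard-singleton x =
  x ∷ [] , [] ∷ [] , refl , λ y → mk⇔ (λ { (here y≡x) → y≡x ; (there ()) }) here

hasCard-Fin : HasCard {Fin n} U n
hasCard-Fin {n} =
  allFin n , Unique.allFin⁺ n , List.length-tabulate (λ i → i) , λ x → mk⇔ _ (λ _ → ∈-allFin x)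

hasCard-Fin×Fin : HasCard {Fin m × Fin n} U (m * n)
hasCard-Fin×Fin {m} {n} = hasCard-⇔
  (λ (i , j) → mk⇔ _ (λ _ → combine i j , tt , sym (Fin.remQuot-combine i j)))
  (hasCard-map (remQuot {m} n) remQuot-injective hasCard-Fin)
  where
  remQuot-injective : Injective _≡_ _≡_ (remQuot {m} n)
  remQuot-injective {x} {y} eq = trans (sym (Fin.combine-remQuot {m} n x))
    (trans (cong (uncurry combine) eq) (Fin.combine-remQuot {m} n y))

hasCard-count : {P : Pred (Fin n) 0ℓ} (P? : Decidable P) → HasCard P (count P?)
hasCard-count {n} P? = filter P? (allFin n) , Unique.filter⁺ P? (Unique.allFin⁺ n) , refl ,
  λ x → mk⇔ (proj₂ ∘ ∈-filter⁻ P? {xs = allFin n}) (∈-filter⁺ P? (∈-allFin x))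

-- Neumaier graphs from a graph with perfect matchings between classes

-- In the application `c` names the glued clique of a vertex, `_~_` is the disjoint union of the
-- copies of Γ, and `_≈_` is the graph F, which adds all edges inside the cliques.
module _
  {V : Set} {p l v : ℕ} (c : V → Fin p) {_~_ _≈_ : Rel V 0ℓ}
  (≈-def : ∀ x y → x ≈ y ⇔ (x ≢ y × (x ~ y ⊎ c x ≡ c y)))
  (~-sym : ∀ {x y} → x ~ y → y ~ x)
  (~⇒c≢ : ∀ {x y} → x ~ y → c x ≢ c y)
  (match : ∀ x κ → c x ≢ κ → ∃ λ y → c y ≡ κ × x ~ y)
  (match-unique : ∀ {x y z} → x ~ y → x ~ z → c y ≡ c z → y ≡ z)
  (~-edgeRegular : ∀ {x y} → x ~ y → HasCard (λ z → x ~ z × y ~ z) l)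
  (class-card : ∀ κ → HasCard (λ x → c x ≡ κ) (2 + l))
  (order : HasCard {V} U v)
  {κ₀ κ₁ : Fin p} (κ₀≢κ₁ : κ₀ ≢ κ₁)
  where

  private
    cross : ∀ {x y} → x ~ y → x ≈ y
    cross xy = from (≈-def _ _) ((λ { refl → ~⇒c≢ xy refl }) , inj₁ xy)

    mates : ∀ {x y} → x ≢ y → c x ≡ c y → x ≈ y
    mates x≢y cx≡cy = from (≈-def _ _) (x≢y , inj₂ cx≡cy)

    classify : ∀ {x y} → x ≈ y → x ~ y ⊎ c x ≡ c y
    classify = proj₂ ∘ to (≈-def _ _)

    ≈⇒≢ : ∀ {x y} → x ≈ y → x ≢ y
    ≈⇒≢ = proj₁ ∘ to (≈-def _ _)

    ≈-sym : ∀ {x y} → x ≈ y → y ≈ x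
    ≈-sym xy with classify xy
    ... | inj₁ x~y   = cross (~-sym x~y)
    ... | inj₂ cx≡cy = mates (≈⇒≢ xy ∘ sym) (sym cx≡cy)

    -- Extends `match` to the class of `x` itself, with `x` as default value. The partner of `x` is
    -- then a function of `κ` on all of `Fin p`, injective because the partner lies in class `κ`.
    match′ : ∀ x κ → ∃ λ y → c y ≡ κ × (c x ≢ κ → x ~ y)
    match′ x κ with c x Fin.≟ κ
    ... | yes cx≡κ = x , cx≡κ , contradiction cx≡κ
    ... | no  cx≢κ = let y , cy≡κ , xy = match x κ cx≢κ in y , cy≡κ , λ _ → xy

    -- The neighbours of `x` correspond to the `p - 1` classes other than its own: `match` supplies
    -- one in each, and `match-unique` shows that there are no more.
    ~-card : ∀ x → HasCard (x ~_) (p ∸ 1)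
    ~-card x = hasCard-⇔
      (λ y → mk⇔
        (λ { (κ , (_ , κ≢) , refl) → proj₂ (proj₂ (match′ x κ)) (κ≢ ∘ sym) })
        (λ xy → let z , cz≡cy , xz = match′ x (c y) in
          c y , (tt , ~⇒c≢ xy ∘ sym) , match-unique xy (xz (~⇒c≢ xy)) (sym cz≡cy)))
      (hasCard-map (λ κ → proj₁ (match′ x κ)) injective
        (hasCard-remove {x = c x} tt (subst (HasCard U) (p≡1+[p∸1] κ₀) hasCard-Fin)))
      where
      injective : Injective _≡_ _≡_ (λ κ → proj₁ (match′ x κ))
      injective {κ} {κ′} eq = trans (sym (proj₁ (proj₂ (match′ x κ))))
        (trans (cong c eq) (proj₁ (proj₂ (match′ x κ′))))
      p≡1+[p∸1] : ∀ {p} → Fin p → p ≡ suc (p ∸ 1)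
      p≡1+[p∸1] {suc p} _ = refl

    -- There are `p - 1` neighbours across the matchings and `1 + l` other members of the class of
    -- `x`.
    ≈-card : ∀ x → HasCard (x ≈_) (p + l)
    ≈-card x = subst (HasCard (x ≈_)) (degree κ₀) (hasCard-⇔
      (λ y → mk⇔
        (λ { (inj₁ xy) → cross xy ; (inj₂ (cy≡cx , y≢x)) → mates (y≢x ∘ sym) (sym cy≡cx) })
        (λ xy → Sum.map₂ (λ cx≡cy → sym cx≡cy , ≈⇒≢ xy ∘ sym) (classify xy)))
      (hasCard-∪ (λ xy (cy≡cx , _) → ~⇒c≢ xy (sym cy≡cx))
        (~-card x) (hasCard-remove refl (class-card (c x)))))
      where
      degree : ∀ {p} → Fin p → (p ∸ 1) + suc l ≡ p + l
      degree {suc p} _ = ℕ.+-suc p l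

    -- If `z` were a clique-mate of `y` matched to `x`, then `x` would have two partners in one
    -- class, forcing `y ≡ z`; likewise with `x` and `y` exchanged. It cannot be a mate of both,
    -- since `x` and `y` lie in different classes.
    ~-common : ∀ {x y z} → x ~ y → (x ~ z × y ~ z) ⇔ (x ≈ z × y ≈ z)
    ~-common {x} {y} {z} xy = mk⇔ (λ (xz , yz) → cross xz , cross yz) back
      where
      back : x ≈ z × y ≈ z → x ~ z × y ~ z
      back (xz , yz) with classify xz | classify yz
      ... | inj₁ x~z   | inj₁ y~z   = x~z , y~z
      ... | inj₁ x~z   | inj₂ cy≡cz = contradiction (match-unique xy x~z cy≡cz) (≈⇒≢ yz)
      ... | inj₂ cx≡cz | inj₁ y~z   =
        contradiction (match-unique (~-sym xy) y~z cx≡cz) (≈⇒≢ xz)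
      ... | inj₂ cx≡cz | inj₂ cy≡cz = contradiction (trans cx≡cz (sym cy≡cz)) (~⇒c≢ xy)

    -- A vertex outside the class has only one partner in it, so it cannot be adjacent to both
    -- mates.
    mates-common : ∀ {x y z} → x ≢ y → c x ≡ c y →
                   ((c z ≡ c x × z ≢ x) × z ≢ y) ⇔ (x ≈ z × y ≈ z)
    mates-common {x} {y} {z} x≢y cx≡cy = mk⇔
      (λ ((cz≡cx , z≢x) , z≢y) →
        mates (z≢x ∘ sym) (sym cz≡cx) , mates (z≢y ∘ sym) (trans (sym cx≡cy) (sym cz≡cx)))
      back
      where
      back : x ≈ z × y ≈ z → (c z ≡ c x × z ≢ x) × z ≢ y
      back (xz , yz) with classify xz | classify yz
      ... | inj₁ x~z   | inj₁ y~z   =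
        contradiction (match-unique (~-sym x~z) (~-sym y~z) cx≡cy) x≢y
      ... | inj₁ x~z   | inj₂ cy≡cz = contradiction (trans cx≡cy cy≡cz) (~⇒c≢ x~z)
      ... | inj₂ cx≡cz | _          = (sym cx≡cz , ≈⇒≢ xz ∘ sym) , ≈⇒≢ yz ∘ sym

    two-mates : ∀ κ → ∃₂ λ x y → c x ≡ κ × c y ≡ κ × x ≢ y
    two-mates κ =
      let x , cx = hasCard-inhabited (class-card κ)
          y , cy , y≢x = hasCard-inhabited (hasCard-remove cx (class-card κ))
      in x , y , cx , cy , y≢x ∘ sym

  isNeumaier : IsNeumaier _≈_ v (p + l) l 1 (2 + l)
  isNeumaier = record
    { simple      = ≈-sym , λ { refl xx → ≈⇒≢ xx refl }
    ; order       = order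
    ; nonComplete = nonComplete
    ; regular     = ≈-card
    ; edgeRegular =
        (let x , y , cx , cy , x≢y = two-mates κ₀ in
          x , y , mates x≢y (trans cx (sym cy))) ,
        λ x y xy → edge xy (classify xy)
    ; e>0         = s≤s z≤n
    ; K           = λ x → c x ≡ κ₀
    ; K-clique    = λ x y cx cy x≢y → mates x≢y (trans cx (sym cy))
    ; K-size      = class-card κ₀
    ; K-regular   = K-regular
    }
    where
    edge : ∀ {x y} → x ≈ y → x ~ y ⊎ c x ≡ c y → HasCard (λ z → x ≈ z × y ≈ z) l
    edge _  (inj₁ x~y)   = hasCard-⇔ (λ z → ~-common x~y) (~-edgeRegular x~y)
    edge {x} {y} xy (inj₂ cx≡cy) = hasCard-⇔ (λ z → mates-common (≈⇒≢ xy) cx≡cy)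
      (hasCard-remove (sym cx≡cy , ≈⇒≢ xy ∘ sym) (hasCard-remove refl (class-card (c x))))

    -- Outside the clique only matching edges lead into it, and the matching provides exactly one.
    K-regular : ∀ x → c x ≢ κ₀ → HasCard (λ y → c y ≡ κ₀ × x ≈ y) 1
    K-regular x cx≢κ₀ =
      let y , cy≡κ₀ , xy = match x κ₀ cx≢κ₀ in hasCard-⇔
      (λ z → mk⇔
        (λ { refl → cy≡κ₀ , cross xy })
        (λ (cz≡κ₀ , xz) → Sum.[
            (λ x~z → match-unique x~z xy (trans cz≡κ₀ (sym cy≡κ₀))) ,
            (λ cx≡cz → contradiction (trans cx≡cz cz≡κ₀) cx≢κ₀) ] (classify xz)))
      (hasCard-singleton y)

    -- Completeness would match a vertex of class `κ₀` with two distinct vertices of class `κ₁`.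
    nonComplete : ¬ IsComplete _≈_
    nonComplete complete =
      let x , cx = hasCard-inhabited (class-card κ₀)
          y , z , cy , cz , y≢z = two-mates κ₁
          x≁mate : ∀ {w} → c w ≡ κ₁ → c x ≢ c w
          x≁mate cw cx≡cw = κ₀≢κ₁ (trans (sym cx) (trans cx≡cw cw))
          x~ : ∀ {w} → c w ≡ κ₁ → x ~ w
          x~ {w} cw = Sum.[ (λ x~w → x~w) , (λ eq → contradiction eq (x≁mate cw)) ]
            (classify (complete x w (x≁mate cw ∘ cong c)))
      in y≢z (match-unique (x~ cy) (x~ cz) (trans cy (sym cz)))

-- Injections of finite sets

-- Pigeonhole: if `j` were missed, punching it out would inject the domain into a set with one
-- element fewer.
injective⇒surjective : {f : Fin n → Fin n} → Injective _≡_ _≡_ f → ∀ j → ∃ λ i → f i ≡ j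
injective⇒surjective {suc n} {f} inj j with Fin.any? (λ i → f i Fin.≟ j)
... | yes i = i
... | no ∄i = contradiction
  (Fin.injective⇒≤ {f = λ i → punchOut (j≢f i)}
    (λ {i} {k} → inj ∘ Fin.punchOut-injective (j≢f i) (j≢f k)))
  ℕ.1+n≰n
  where
  j≢f : ∀ i → j ≢ f i
  j≢f i j≡fi = ∄i (i , sym j≡fi)

-- Choosing preimages gives a self-map `h` with `f ∘ h = g`. It is injective because `g` is, hence
-- surjective, so every argument of `f` is some `h i` and injectivity passes from `g` to `f`.
covers-injection⇒injective : (f g : Fin n → A) → Injective _≡_ _≡_ g →
                             (∀ i → ∃ λ j → f j ≡ g i) → Injective _≡_ _≡_ f
covers-injection⇒injective {n} f g g-inj cover {j} {k} fj≡fk =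
  let i  , hi≡j  = injective⇒surjective h-inj j
      i′ , hi′≡k = injective⇒surjective h-inj k
  in trans (sym hi≡j) (trans
       (cong h (g-inj (trans (sym (f-h hi≡j)) (trans fj≡fk (f-h hi′≡k)))))
       hi′≡k)
  where
  h : Fin n → Fin n
  h = proj₁ ∘ cover
  f-h : ∀ {i j} → h i ≡ j → f j ≡ g i
  f-h {i} refl = proj₂ (cover i)
  h-inj : Injective _≡_ _≡_ h
  h-inj hi≡hi′ = g-inj (trans (sym (f-h hi≡hi′)) (f-h refl))

-- The ring ℤ/n

module Residues (n : ℕ) .{{_ : NonZero n}} where

  private module R = RawRing (ℤ/ n)

  [_] : ℕ → Fin n
  [ m ] = m mod n

  toℕ-[] : ∀ m → toℕ [ m ] ≡ m % n
  toℕ-[] m = Fin.toℕ-fromℕ< (ℕ.m%n<n m n)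

  []-cong : ∀ {k m} → k % n ≡ m % n → [ k ] ≡ [ m ]
  []-cong {k} {m} eq = Fin.toℕ-injective (trans (toℕ-[] k) (trans eq (sym (toℕ-[] m))))

  []-toℕ : ∀ x → [ toℕ x ] ≡ x
  []-toℕ x = Fin.toℕ-injective (trans (toℕ-[] (toℕ x)) (ℕ.m<n⇒m%n≡m (Fin.toℕ<n x)))

  []-+ : ∀ k m → [ k ] R.+ [ m ] ≡ [ k + m ]
  []-+ k m = []-cong (trans
    (cong (_% n) (cong₂ _+_ (toℕ-[] k) (toℕ-[] m)))
    (sym (ℕ.%-distribˡ-+ k m n)))

  []-* : ∀ k m → [ k ] R.* [ m ] ≡ [ k * m ]
  []-* k m = []-cong (trans
    (cong (_% n) (cong₂ _*_ (toℕ-[] k) (toℕ-[] m)))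
    (sym (ℕ.%-distribˡ-* k m n)))

  private
    -- Since `toℕ` is a section of `[_]`, this and its three companions pull each ring law back to
    -- the same law in ℕ.
    []-+ʳ : ∀ k x → [ k ] R.+ x ≡ [ k + toℕ x ]
    []-+ʳ k x = trans (cong ([ k ] R.+_) (sym ([]-toℕ x))) ([]-+ k (toℕ x))

    []-+ˡ : ∀ x k → x R.+ [ k ] ≡ [ toℕ x + k ]
    []-+ˡ x k = trans (cong (R._+ [ k ]) (sym ([]-toℕ x))) ([]-+ (toℕ x) k)

    []-*ʳ : ∀ k x → [ k ] R.* x ≡ [ k * toℕ x ]
    []-*ʳ k x = trans (cong ([ k ] R.*_) (sym ([]-toℕ x))) ([]-* k (toℕ x))

    []-*ˡ : ∀ x k → x R.* [ k ] ≡ [ toℕ x * k ]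
    []-*ˡ x k = trans (cong (R._* [ k ]) (sym ([]-toℕ x))) ([]-* (toℕ x) k)

    +-assoc : ∀ x y z → (x R.+ y) R.+ z ≡ x R.+ (y R.+ z)
    +-assoc x y z = trans ([]-+ʳ _ z)
      (trans (cong [_] (ℕ.+-assoc (toℕ x) (toℕ y) (toℕ z))) (sym ([]-+ˡ x _)))

    *-assoc : ∀ x y z → (x R.* y) R.* z ≡ x R.* (y R.* z)
    *-assoc x y z = trans ([]-*ʳ _ z)
      (trans (cong [_] (ℕ.*-assoc (toℕ x) (toℕ y) (toℕ z))) (sym ([]-*ˡ x _)))

    +-comm : ∀ x y → x R.+ y ≡ y R.+ x
    +-comm x y = cong [_] (ℕ.+-comm (toℕ x) (toℕ y))

    *-comm : ∀ x y → x R.* y ≡ y R.* x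
    *-comm x y = cong [_] (ℕ.*-comm (toℕ x) (toℕ y))

    +-identityˡ : ∀ x → R.0# R.+ x ≡ x
    +-identityˡ x = trans ([]-+ʳ 0 x) ([]-toℕ x)

    *-identityˡ : ∀ x → R.1# R.* x ≡ x
    *-identityˡ x = trans ([]-*ʳ 1 x) (trans (cong [_] (ℕ.*-identityˡ (toℕ x))) ([]-toℕ x))

    -‿inverseˡ : ∀ x → (R.- x) R.+ x ≡ R.0#
    -‿inverseˡ x = trans ([]-+ʳ (n ∸ toℕ x) x) (trans
      (cong [_] (ℕ.m∸n+n≡m (ℕ.<⇒≤ (Fin.toℕ<n x))))
      ([]-cong (ℕ.[m+n]%n≡m%n 0 n)))

    *-distribˡ-+ : ∀ x y z → x R.* (y R.+ z) ≡ x R.* y R.+ x R.* z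
    *-distribˡ-+ x y z = trans ([]-*ˡ x _) (trans
      (cong [_] (ℕ.*-distribˡ-+ (toℕ x) (toℕ y) (toℕ z)))
      (sym ([]-+ _ _)))

    comm∧idˡ⇒id : ∀ (_∙_ : Fin n → Fin n → Fin n) {e} → (∀ x y → x ∙ y ≡ y ∙ x) →
                  (∀ x → e ∙ x ≡ x) → (∀ x → e ∙ x ≡ x) × (∀ x → x ∙ e ≡ x)
    comm∧idˡ⇒id _ comm id = id , λ x → trans (comm x _) (id x)

  commutativeRing : CommutativeRing 0ℓ 0ℓ
  commutativeRing = record
    { Carrier = Fin n ; _≈_ = _≡_ ; _+_ = R._+_ ; _*_ = R._*_ ; -_ = R.-_
    ; 0# = R.0# ; 1# = R.1#
    ; isCommutativeRing = record
      { isRing = record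
        { +-isAbelianGroup = record
          { isGroup = record
            { isMonoid = record
              { isSemigroup = record
                { isMagma = record { isEquivalence = isEquivalence ; ∙-cong = cong₂ R._+_ }
                ; assoc = +-assoc
                }
              ; identity = comm∧idˡ⇒id R._+_ +-comm +-identityˡ
              }
            ; inverse = -‿inverseˡ , λ x → trans (+-comm x _) (-‿inverseˡ x)
            ; ⁻¹-cong = cong R.-_
            }
          ; comm = +-comm
          }
        ; *-cong = cong₂ R._*_
        ; *-assoc = *-assoc
        ; *-identity = comm∧idˡ⇒id R._*_ *-comm *-identityˡ
        ; distrib = *-distribˡ-+ , λ x y z → trans (*-comm _ x)
            (trans (*-distribˡ-+ x y z) (cong₂ R._+_ (*-comm x y) (*-comm x z)))
        }
      ; *-comm = *-comm
      }
    }

  open CommutativeRing commutativeRing public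
    using (ring; semiring; +-monoid)

  open Exp semiring public using (_^_; ^-homo-*; ^-assocʳ)
  open Mult +-monoid public using () renaming (_×_ to _⋆_)

  ⋆-[] : ∀ k m → k ⋆ [ m ] ≡ [ k * m ]
  ⋆-[] zero    m = refl
  ⋆-[] (suc k) m = trans (cong ([ m ] R.+_) (⋆-[] k m)) ([]-+ m (k * m))

-- Identities in a commutative ring

module RingIdentities (R : CommutativeRing 0ℓ 0ℓ) where
  private module R = CommutativeRing R
  open R using (1#; _≈_)
  open AbelianGroupProperties R.+-abelianGroup
  open import Relation.Binary.Reasoning.Setoid R.setoid

  x-[x-y]≈y : ∀ x y → x R.- (x R.- y) ≈ y
  x-[x-y]≈y x y = begin
    x R.- (x R.- y)  ≈⟨ R.+-congˡ (⁻¹-anti-homo‿- x y) ⟩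
    x R.+ (y R.- x)  ≈⟨ R.+-assoc x y (R.- x) ⟨
    (x R.+ y) R.- x  ≈⟨ xyx⁻¹≈y x y ⟩
    y                ∎

  [x-y]+[y-z]≈x-z : ∀ x y z → (x R.- y) R.+ (y R.- z) ≈ x R.- z
  [x-y]+[y-z]≈x-z x y z = begin
    (x R.- y) R.+ (y R.- z)      ≈⟨ R.+-assoc x (R.- y) (y R.- z) ⟩
    x R.+ (R.- y R.+ (y R.- z))  ≈⟨ R.+-congˡ (\\-leftDividesʳ y (R.- z)) ⟩
    x R.- z                      ∎

  x-y≈z⇒y≈x-z : ∀ {x y z} → x R.- y ≈ z → y ≈ x R.- z
  x-y≈z⇒y≈x-z {x} {y} {z} eq = begin
    y                ≈⟨ x-[x-y]≈y x y ⟨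
    x R.- (x R.- y)  ≈⟨ R.+-congˡ (R.-‿cong eq) ⟩
    x R.- z          ∎

  -- Used for common neighbours in Γ: with `s = x - y` and `z = x - s(v + 1)`, the difference
  -- `y - z` is `sv`, again a product of two elements of the connection set when `v` lies in it.
  y-[x-[x-y][v+1]]≈[x-y]v : ∀ x y v → y R.- (x R.- (x R.- y) R.* (v R.+ 1#)) ≈ (x R.- y) R.* v
  y-[x-[x-y][v+1]]≈[x-y]v x y v = begin
    y R.- (x R.- s R.* (v R.+ 1#))                  ≈⟨ [x-y]+[y-z]≈x-z y x _ ⟨
    (y R.- x) R.+ (x R.- (x R.- s R.* (v R.+ 1#)))  ≈⟨ R.+-cong (R.sym (⁻¹-anti-homo‿- x y))
                                                                 (x-[x-y]≈y x _) ⟩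
    R.- s R.+ s R.* (v R.+ 1#)                      ≈⟨ R.+-congˡ (R.distribˡ s v 1#) ⟩
    R.- s R.+ (s R.* v R.+ s R.* 1#)                ≈⟨ R.+-congˡ (R.+-congˡ (R.*-identityʳ s)) ⟩
    R.- s R.+ (s R.* v R.+ s)                       ≈⟨ R.+-congˡ (R.+-comm (s R.* v) s) ⟩
    R.- s R.+ (s R.+ s R.* v)                       ≈⟨ \\-leftDividesʳ s (s R.* v) ⟩
    s R.* v                                         ∎
    where s = x R.- y

  inverse-cancelˡ : ∀ x y {z} → y R.* x ≈ 1# → y R.* (x R.* z) ≈ z
  inverse-cancelˡ x y {z} yx≈1 = begin
    y R.* (x R.* z)  ≈⟨ R.*-assoc y x z ⟨
    y R.* x R.* z    ≈⟨ R.*-congʳ yx≈1 ⟩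
    1# R.* z         ≈⟨ R.*-identityˡ z ⟩
    z                ∎

-- Reduction of ℤ/N modulo a divisor of N

module Reduction (N p : ℕ) .{{_ : NonZero N}} .{{_ : NonZero p}} (p∣N : p ∣ N) where

  private
    module ℤN = Residues N
    module ℤp = Residues p
    module R = CommutativeRing ℤN.commutativeRing
    module Rₚ = CommutativeRing ℤp.commutativeRing

  ρ : Fin N → Fin p
  ρ x = ℤp.[ toℕ x ]

  ρ-[] : ∀ m → ρ ℤN.[ m ] ≡ ℤp.[ m ]
  ρ-[] m = ℤp.[]-cong (trans (cong (_% p) (ℤN.toℕ-[] m)) (ℕ.m∣n⇒o%n%m≡o%m p N m p∣N))

  ρ-+ : ∀ x y → ρ (x R.+ y) ≡ ρ x Rₚ.+ ρ y
  ρ-+ x y = trans (ρ-[] _) (sym (ℤp.[]-+ _ _))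

  ρ-* : ∀ x y → ρ (x R.* y) ≡ ρ x Rₚ.* ρ y
  ρ-* x y = trans (ρ-[] _) (sym (ℤp.[]-* _ _))

  ρ-neg : ∀ x → ρ (R.- x) ≡ Rₚ.- ρ x
  ρ-neg x = GroupProperties.inverseˡ-unique Rₚ.+-group _ _
    (trans (sym (ρ-+ (R.- x) x)) (trans (cong ρ (R.-‿inverseˡ x)) (ρ-[] 0)))

  ρ-- : ∀ x y → ρ (x R.- y) ≡ ρ x Rₚ.- ρ y
  ρ-- x y = trans (ρ-+ x _) (cong (ρ x Rₚ.+_) (ρ-neg y))

  ρ-^ : ∀ x n → ρ (x ℤN.^ n) ≡ ρ x ℤp.^ n
  ρ-^ x zero    = ρ-[] 1
  ρ-^ x (suc n) = trans (ρ-* x _) (cong (ρ x Rₚ.*_) (ρ-^ x n))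

  ρ≡0⇒multiple : ∀ x → ρ x ≡ Rₚ.0# → ∃ λ k → x ≡ k ℤN.⋆ ℤN.[ p ]
  ρ≡0⇒multiple x ρx≡0
    with divides k eq ← m%n≡0⇒n∣m (toℕ x) p
      (trans (sym (ℤp.toℕ-[] _)) (trans (cong toℕ ρx≡0)
        (trans (ℤp.toℕ-[] 0) (ℕ.m<n⇒m%n≡m (ℕ.>-nonZero⁻¹ p)))))
    = k , trans (sym (ℤN.[]-toℕ x)) (trans (cong ℤN.[_] eq) (sym (ℤN.⋆-[] k p)))

-- Units modulo a prime, and halving `p - 1`

nonzero⇒unit : ∀ p .{{_ : NonZero p}} → Prime p →
               let open CommutativeRing (Residues.commutativeRing p) in
               ∀ u → u ≢ 0# → IsUnit (ℤ/ p) u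
nonzero⇒unit p p-prime u u≢0 = unit (coprime-Bézout (prime⇒coprime p-prime (Fin.toℕ<n u)))
  where
  open Residues p
  module R = CommutativeRing commutativeRing
  instance
    u-nonZero : NonZero (toℕ u)
    u-nonZero = ℕ.≢-nonZero λ tu≡0 → u≢0 (trans (sym ([]-toℕ u)) (cong [_] tu≡0))
  [y]u : ∀ y → [ y ] R.* u ≡ [ y * toℕ u ]
  [y]u y = trans (cong ([ y ] R.*_) (sym ([]-toℕ u))) ([]-* y (toℕ u))
  [kp] : ∀ k m → [ m + k * p ] ≡ [ m ]
  [kp] k m = []-cong (ℕ.[m+kn]%n≡m%n m k p)
  unit : Bézout.Identity 1 p (toℕ u) → IsUnit (ℤ/ p) u
  unit (Bézout.-+ x y eq) = [ y ] , yu≡1 , trans (R.*-comm u _) yu≡1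
    where
    yu≡1 : [ y ] R.* u ≡ R.1#
    yu≡1 = trans ([y]u y) (trans (cong [_] (sym eq)) ([kp] x 1))
  -- Bézout over ℕ comes in two sign patterns; here `1 + y u = x p`, so the inverse of `u` is
  -- `- [ y ]`.
  unit (Bézout.+- x y eq) = R.- [ y ] , -yu≡1 , trans (R.*-comm u _) -yu≡1
    where
    1+yu≡0 : R.1# R.+ [ y ] R.* u ≡ R.0#
    1+yu≡0 = trans (cong (R.1# R.+_) ([y]u y)) (trans ([]-+ 1 _) (trans (cong [_] eq) ([kp] x 0)))
    -yu≡1 : R.- [ y ] R.* u ≡ R.1#
    -yu≡1 = trans (sym (RingProperties.-‿distribˡ-* ring [ y ] u))
      (sym (GroupProperties.inverseˡ-unique R.+-group _ _ 1+yu≡0))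

-- Lets `a ^ (p - 1)` be written as the square of the half power, which is `- 1`.
odd⇒[n∸1]-even : ∀ n → ¬ (2 ∣ n) → (n ∸ 1) / 2 + (n ∸ 1) / 2 ≡ n ∸ 1
odd⇒[n∸1]-even n 2∤n with n % 2 in eq | ℕ.m%n<n n 2
... | 0 | _ = contradiction (m%n≡0⇒n∣m n 2 eq) 2∤n
... | suc (suc _) | s≤s (s≤s ())
... | 1 | _ = trans (sym (trans (ℕ.*-comm ((n ∸ 1) / 2) 2)
    (cong (λ m → (n ∸ 1) / 2 + m) (ℕ.+-identityʳ _))))
  (ℕ.m/n*n≡m (divides (n / 2) (cong (_∸ 1)
    (trans (ℕ.m≡m%n+[m/n]*n n 2) (cong (_+ n / 2 * 2) eq)))))

-- The connection set and the graph Γ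

module ConnectionSet
  (p q : ℕ) .{{_ : NonZero p}} .{{_ : NonZero q}} (p-prime : Prime p) (odd : ¬ (2 ∣ p))
  (a : Fin (p * q))
  (generates : GeneratesUnits (ℤ/ p) (toℕ a mod p))
  (half : _^_ (RawRing.rawSemiring (ℤ/pq p q)) a ((p ∸ 1) / 2)
          ≡ RawRing.-_ (ℤ/pq p q) (RawRing.1# (ℤ/pq p q)))
  where

  private instance
    pq-nonZero : NonZero (p * q)
    pq-nonZero = ℕ.m*n≢0 p q

  private
    module ℤpq = Residues (p * q)
    module ℤp = Residues p
  module R = CommutativeRing ℤpq.commutativeRing
  module Rₚ = CommutativeRing ℤp.commutativeRing
  open Reduction (p * q) p (m∣m*n q) public
  open RingIdentities ℤpq.commutativeRing
  open ≡-Reasoning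

  private
    Sₐ : Pred (Fin (p * q)) 0ℓ
    Sₐ = S p q a

    1<p : 1 < p
    1<p = ℕ.nonTrivial⇒n>1 p {{prime⇒nonTrivial p-prime}}

    instance
      p∸1-nonZero : NonZero (p ∸ 1)
      p∸1-nonZero = ℕ.>-nonZero (ℕ.m<n⇒0<n∸m 1<p)

    a^[p-1]≡1 : a ℤpq.^ (p ∸ 1) ≡ R.1#
    a^[p-1]≡1 = begin
      a ℤpq.^ (p ∸ 1)                         ≡⟨ cong (a ℤpq.^_) (odd⇒[n∸1]-even p odd) ⟨
      a ℤpq.^ (h + h)                         ≡⟨ ℤpq.^-homo-* a h h ⟩
      (a ℤpq.^ h) R.* (a ℤpq.^ h)             ≡⟨ cong₂ R._*_ half half ⟩
      (R.- R.1#) R.* (R.- R.1#)               ≡⟨ RingProperties.-1*x≈-x ℤpq.ring _ ⟩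
      R.- (R.- R.1#)                          ≡⟨ GroupProperties.⁻¹-involutive R.+-group R.1# ⟩
      R.1#                                    ∎
      where h = (p ∸ 1) / 2

    1^n≡1 : ∀ n → R.1# ℤpq.^ n ≡ R.1#
    1^n≡1 zero    = refl
    1^n≡1 (suc n) = trans (R.*-identityˡ _) (1^n≡1 n)

    -- Exponents may be reduced modulo `p - 1` because `a ^ (p - 1)` is 1. Thus `S` contains every
    -- natural power of `a`, from which its closure properties follow.
    pow∈S : ∀ n → Sₐ (a ℤpq.^ n)
    pow∈S n = n % d , ℕ.m%n<n n d , (begin
      a ℤpq.^ n                               ≡⟨ cong (a ℤpq.^_) n≡ ⟩
      a ℤpq.^ (n % d + d * (n / d))           ≡⟨ ℤpq.^-homo-* a (n % d) _ ⟩
      aʳ R.* (a ℤpq.^ (d * (n / d)))          ≡⟨ cong (aʳ R.*_) (ℤpq.^-assocʳ a d (n / d)) ⟨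
      aʳ R.* ((a ℤpq.^ d) ℤpq.^ (n / d))      ≡⟨ cong (λ x → aʳ R.* (x ℤpq.^ (n / d))) a^[p-1]≡1 ⟩
      aʳ R.* (R.1# ℤpq.^ (n / d))             ≡⟨ cong (aʳ R.*_) (1^n≡1 (n / d)) ⟩
      aʳ R.* R.1#                             ≡⟨ R.*-identityʳ aʳ ⟩
      aʳ                                      ∎)
      where
      d = p ∸ 1
      aʳ = a ℤpq.^ (n % d)
      n≡ : n ≡ n % d + d * (n / d)
      n≡ = trans (ℕ.m≡m%n+[m/n]*n n d) (cong (λ m → n % d + m) (ℕ.*-comm (n / d) d))

  S-* : ∀ {x y} → Sₐ x → Sₐ y → Sₐ (x R.* y)
  S-* (i , _ , refl) (j , _ , refl) = subst Sₐ (ℤpq.^-homo-* a i j) (pow∈S (i + j))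

  -- Negation is multiplication by `a ^ ((p - 1) / 2)`, an element of `S`.
  S-neg : ∀ {x} → Sₐ x → Sₐ (R.- x)
  S-neg {x} Sx = subst Sₐ
    (trans (cong (R._* x) half) (RingProperties.-1*x≈-x ℤpq.ring x))
    (S-* (pow∈S ((p ∸ 1) / 2)) Sx)

  S-sym : ∀ {x y} → Sₐ (x R.- y) → Sₐ (y R.- x)
  S-sym {x} {y} = subst Sₐ (AbelianGroupProperties.⁻¹-anti-homo‿- R.+-abelianGroup x y) ∘ S-neg

  S-inverse : ∀ {x} → Sₐ x → ∃ λ y → Sₐ y × y R.* x ≡ R.1#
  S-inverse (j , j<d , refl) = a ℤpq.^ (p ∸ 1 ∸ j) , pow∈S (p ∸ 1 ∸ j) ,
    trans (sym (ℤpq.^-homo-* a (p ∸ 1 ∸ j) j))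
      (trans (cong (a ℤpq.^_) (ℕ.m∸n+n≡m (ℕ.<⇒≤ j<d))) a^[p-1]≡1)

  -- Reduction of `S` modulo `p`

  private
    toℕ-0# : toℕ Rₚ.0# ≡ 0
    toℕ-0# = trans (ℤp.toℕ-[] 0) (ℕ.m<n⇒m%n≡m (ℕ.<-trans (s≤s z≤n) 1<p))

  -- An element of `S` is invertible, so reducing to 0 would give `1 ≡ 0` modulo `p`.
  ρ-S≢0 : ∀ {x} → Sₐ x → ρ x ≢ Rₚ.0#
  ρ-S≢0 {x} Sx ρx≡0 = ℕ.1+n≢0 {0} (begin
    1                  ≡⟨ ℕ.m<n⇒m%n≡m 1<p ⟨
    1 % p              ≡⟨ ℤp.toℕ-[] 1 ⟨
    toℕ Rₚ.1#          ≡⟨ cong toℕ 1≡0 ⟩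
    toℕ Rₚ.0#          ≡⟨ toℕ-0# ⟩
    0                  ∎)
    where
    1≡0 : Rₚ.1# ≡ Rₚ.0#
    1≡0 = let y , _ , yx≡1 = S-inverse Sx in begin
      Rₚ.1#              ≡⟨ ρ-[] 1 ⟨
      ρ R.1#             ≡⟨ cong ρ yx≡1 ⟨
      ρ (y R.* x)        ≡⟨ ρ-* y x ⟩
      ρ y Rₚ.* ρ x       ≡⟨ cong (ρ y Rₚ.*_) ρx≡0 ⟩
      ρ y Rₚ.* Rₚ.0#     ≡⟨ Rₚ.zeroʳ (ρ y) ⟩
      Rₚ.0#              ∎

  ρ-S-surjective : ∀ u → u ≢ Rₚ.0# → ∃ λ s → Sₐ s × ρ s ≡ u
  ρ-S-surjective u u≢0 with proj₂ generates u (nonzero⇒unit p p-prime u u≢0)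
  ... | n , inj₁ u≡bⁿ = a ℤpq.^ n , pow∈S n , trans (ρ-^ a n) (sym u≡bⁿ)
  -- A negative power: `u` is the inverse of `ρ a ^ n`, hence the image of the inverse of `a ^ n`,
  -- which `S` contains.
  ... | n , inj₂ ubⁿ≡1 with y , Sy , yaⁿ≡1 ← S-inverse (pow∈S n) = y , Sy , (begin
    ρ y                                ≡⟨ Rₚ.*-identityʳ (ρ y) ⟨
    ρ y Rₚ.* Rₚ.1#                     ≡⟨ cong (ρ y Rₚ.*_) ubⁿ≡1 ⟨
    ρ y Rₚ.* (u Rₚ.* bⁿ)               ≡⟨ cong (ρ y Rₚ.*_) (Rₚ.*-comm u bⁿ) ⟩
    ρ y Rₚ.* (bⁿ Rₚ.* u)               ≡⟨ RingIdentities.inverse-cancelˡ ℤp.commutativeRing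
                                            bⁿ (ρ y) ρy-inverse ⟩
    u                                  ∎)
    where
    bⁿ : Fin p
    bⁿ = ρ a ℤp.^ n
    ρy-inverse : ρ y Rₚ.* bⁿ ≡ Rₚ.1#
    ρy-inverse = trans (cong (ρ y Rₚ.*_) (sym (ρ-^ a n)))
      (trans (sym (ρ-* y _)) (trans (cong ρ yaⁿ≡1) (ρ-[] 1)))

  -- By surjectivity, the `p - 1` values of `f`, the residues of the powers of `a`, cover the
  -- `p - 1` distinct values of `g`, the residues 1 to `p - 1`. Hence `f` has no repetitions.
  ρ-S-injective : ∀ {s s′} → Sₐ s → Sₐ s′ → ρ s ≡ ρ s′ → s ≡ s′
  ρ-S-injective (i , i<d , refl) (j , j<d , refl) ρ≡ = cong (a ℤpq.^_) (begin
    i                    ≡⟨ Fin.toℕ-fromℕ< i<d ⟨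
    toℕ (fromℕ< i<d)     ≡⟨ cong toℕ (covers-injection⇒injective f g g-injective cover
                              (trans (f-fromℕ< i<d) (trans ρ≡ (sym (f-fromℕ< j<d))))) ⟩
    toℕ (fromℕ< j<d)     ≡⟨ Fin.toℕ-fromℕ< j<d ⟩
    j                    ∎)
    where
    f : Fin (p ∸ 1) → Fin p
    f i = ρ (a ℤpq.^ toℕ i)
    f-fromℕ< : ∀ {i} (i<d : i < p ∸ 1) → f (fromℕ< i<d) ≡ ρ (a ℤpq.^ i)
    f-fromℕ< i<d = cong (λ i → ρ (a ℤpq.^ i)) (Fin.toℕ-fromℕ< i<d)
    g : Fin (p ∸ 1) → Fin p
    g i = ℤp.[ suc (toℕ i) ]
    toℕ-g : ∀ i → toℕ (g i) ≡ suc (toℕ i)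
    toℕ-g i = trans (ℤp.toℕ-[] _) (ℕ.m<n⇒m%n≡m
      (subst (suc (toℕ i) <_) (ℕ.suc-pred p) (s≤s (Fin.toℕ<n i))))
    g-injective : Injective _≡_ _≡_ g
    g-injective {i} {j} eq = Fin.toℕ-injective (ℕ.suc-injective
      (trans (sym (toℕ-g i)) (trans (cong toℕ eq) (toℕ-g j))))
    g≢0 : ∀ i → g i ≢ Rₚ.0#
    g≢0 i eq = ℕ.1+n≢0 (trans (sym (toℕ-g i)) (trans (cong toℕ eq) toℕ-0#))
    cover : ∀ i → ∃ λ j → f j ≡ g i
    cover i with _ , (j , j<d , refl) , eq ← ρ-S-surjective (g i) (g≢0 i) =
      fromℕ< j<d , trans (f-fromℕ< j<d) eq

  -- Perfect matchings and edge-regularity of Γ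

  Γ-matching : ∀ x u → ρ x ≢ u → ∃ λ y → ρ y ≡ u × Sₐ (x R.- y)
  Γ-matching x u ρx≢u
    with s , Ss , ρs ← ρ-S-surjective (ρ x Rₚ.- u)
      (ρx≢u ∘ GroupProperties.x∙y⁻¹≈ε⇒x≈y Rₚ.+-group (ρ x) u) =
    -- Subtracting from `x` the lift `s` in `S` of `ρ x - u` lands in the residue class `u`.
    x R.- s ,
    (begin
      ρ (x R.- s)               ≡⟨ ρ-- x s ⟩
      ρ x Rₚ.- ρ s              ≡⟨ cong (λ t → ρ x Rₚ.- t) ρs ⟩
      ρ x Rₚ.- (ρ x Rₚ.- u)     ≡⟨ RingIdentities.x-[x-y]≈y ℤp.commutativeRing (ρ x) u ⟩
      u                         ∎) ,
    subst Sₐ (sym (x-[x-y]≈y x s)) Ss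

  -- Both differences lie in `S` and have the same residue, so they agree.
  Γ-matching-unique : ∀ {x y z} → Sₐ (x R.- y) → Sₐ (x R.- z) → ρ y ≡ ρ z → y ≡ z
  Γ-matching-unique {x} {y} {z} Sxy Sxz ρy≡ρz = begin
    y                   ≡⟨ x-[x-y]≈y x y ⟨
    x R.- (x R.- y)     ≡⟨ cong (λ w → x R.- w) (ρ-S-injective Sxy Sxz (begin
      ρ (x R.- y)         ≡⟨ ρ-- x y ⟩
      ρ x Rₚ.- ρ y        ≡⟨ cong (λ w → ρ x Rₚ.- w) ρy≡ρz ⟩
      ρ x Rₚ.- ρ z        ≡⟨ ρ-- x z ⟨
      ρ (x R.- z)         ∎)) ⟩
    x R.- (x R.- z)     ≡⟨ x-[x-y]≈y x z ⟩
    z                   ∎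

  Γ⇒ρ≢ : ∀ {x y} → Sₐ (x R.- y) → ρ x ≢ ρ y
  Γ⇒ρ≢ {x} {y} Sxy ρx≡ρy = ρ-S≢0 Sxy
    (trans (ρ-- x y) (GroupProperties.x≈y⇒x∙y⁻¹≈ε Rₚ.+-group ρx≡ρy))

  -- The common neighbours of x and y are x - su with s = x - y and u ∈ S ∩ (S + 1).
  Γ-edgeRegular : ∀ {x y} → Sₐ (x R.- y) →
                  HasCard (λ z → Sₐ (x R.- z) × Sₐ (y R.- z)) (∣S∩S+1∣ p q a)
  Γ-edgeRegular {x} {y} Ss with s⁻¹ , Ss⁻¹ , s⁻¹s≡1 ← S-inverse Ss = hasCard-⇔
    (λ z → mk⇔
      (λ { (_ , (Su , v , Sv , refl) , refl) →
        subst Sₐ (sym (x-[x-y]≈y x _)) (S-* Ss Su) ,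
        subst Sₐ (sym (y-[x-[x-y][v+1]]≈[x-y]v x y v)) (S-* Ss Sv) })
      (λ (Sxz , Syz) →
        -- Dividing `x - z = s + (y - z)` by `s` exhibits this element as 1 plus an element of `S`.
        s⁻¹ R.* (x R.- z) ,
        (S-* Ss⁻¹ Sxz , s⁻¹ R.* (y R.- z) , S-* Ss⁻¹ Syz , (begin
          s⁻¹ R.* (x R.- z)                            ≡⟨ cong (s⁻¹ R.*_) ([x-y]+[y-z]≈x-z x y z) ⟨
          s⁻¹ R.* (s R.+ (y R.- z))                    ≡⟨ R.distribˡ s⁻¹ s (y R.- z) ⟩
          s⁻¹ R.* s R.+ s⁻¹ R.* (y R.- z)              ≡⟨ cong (R._+ (s⁻¹ R.* (y R.- z))) s⁻¹s≡1 ⟩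
          R.1# R.+ s⁻¹ R.* (y R.- z)                   ≡⟨ R.+-comm R.1# _ ⟩
          s⁻¹ R.* (y R.- z) R.+ R.1#                   ∎)) ,
        x-y≈z⇒y≈x-z (sym (inverse-cancelˡ s⁻¹ s (trans (R.*-comm s s⁻¹) s⁻¹s≡1)))))
    (hasCard-map (λ u → x R.- s R.* u) injective (hasCard-count _))
    where
    s : Fin (p * q)
    s = x R.- y
    injective : Injective _≡_ _≡_ (λ u → x R.- s R.* u)
    injective {u} {v} eq = begin
      u                        ≡⟨ inverse-cancelˡ s s⁻¹ s⁻¹s≡1 ⟨
      s⁻¹ R.* (s R.* u)        ≡⟨ cong (s⁻¹ R.*_) (trans (x-y≈z⇒y≈x-z eq) (x-[x-y]≈y x _)) ⟩
      s⁻¹ R.* (s R.* v)        ≡⟨ inverse-cancelˡ s s⁻¹ s⁻¹s≡1 ⟩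
      v                        ∎

-- The cosets of ⟨p⟩

module Cosets (p q : ℕ) .{{_ : NonZero p}} .{{_ : NonZero q}} where

  private instance
    pq-nonZero : NonZero (p * q)
    pq-nonZero = ℕ.m*n≢0 p q

  private
    module ℤpq = Residues (p * q)
    module ℤp = Residues p
    module R = CommutativeRing ℤpq.commutativeRing
    module Rₚ = CommutativeRing ℤp.commutativeRing
  open Reduction (p * q) p (m∣m*n q)
  open ≡-Reasoning

  -- Identifies the subgroup with the kernel of reduction modulo `p`, so that its cosets become the
  -- fibres of `ρ`.
  ⟨p⟩⇔ρ≡0 : ∀ x → ⟨p⟩ p q x ⇔ ρ x ≡ Rₚ.0#
  ⟨p⟩⇔ρ≡0 x = mk⇔ forth (λ ρx≡0 → let k , x≡kp = ρ≡0⇒multiple x ρx≡0 in k , inj₁ x≡kp)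
    where
    ρ-kp : ∀ k → ρ (k ℤpq.⋆ ℤpq.[ p ]) ≡ Rₚ.0#
    ρ-kp k = trans (cong ρ (ℤpq.⋆-[] k p)) (trans (ρ-[] (k * p)) (ℤp.[]-cong (ℕ.[m+kn]%n≡m%n 0 k p)))
    forth : ⟨p⟩ p q x → ρ x ≡ Rₚ.0#
    forth (k , inj₁ x≡kp)   = trans (cong ρ x≡kp) (ρ-kp k)
    forth (k , inj₂ x+kp≡0) = begin
      ρ x                                    ≡⟨ Rₚ.+-identityʳ (ρ x) ⟨
      ρ x Rₚ.+ Rₚ.0#                         ≡⟨ cong (ρ x Rₚ.+_) (ρ-kp k) ⟨
      ρ x Rₚ.+ ρ (k ℤpq.⋆ ℤpq.[ p ])         ≡⟨ ρ-+ x _ ⟨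
      ρ (x R.+ k ℤpq.⋆ ℤpq.[ p ])            ≡⟨ cong ρ x+kp≡0 ⟩
      ρ R.0#                                 ≡⟨ ρ-[] 0 ⟩
      Rₚ.0#                                  ∎

  coset⇔ρ≡ : ∀ g x → coset p q g x ⇔ ρ x ≡ ρ g
  coset⇔ρ≡ g x = mk⇔
    (λ x∈ → GroupProperties.x∙y⁻¹≈ε⇒x≈y Rₚ.+-group _ _
      (trans (sym (ρ-- x g)) (to (⟨p⟩⇔ρ≡0 (x R.- g)) x∈)))
    (λ ρx≡ρg → from (⟨p⟩⇔ρ≡0 (x R.- g))
      (trans (ρ-- x g) (GroupProperties.x≈y⇒x∙y⁻¹≈ε Rₚ.+-group ρx≡ρg)))

  -- Division with remainder by `p`, read as a numbering of each residue class by the quotients in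
  -- `Fin q`.
  residue : Fin p → Fin q → Fin (p * q)
  residue r j = cast (ℕ.*-comm q p) (combine j r)

  toℕ-residue : ∀ r j → toℕ (residue r j) ≡ p * toℕ j + toℕ r
  toℕ-residue r j = trans (Fin.toℕ-cast _ (combine j r)) (Fin.toℕ-combine j r)

  ρ-residue : ∀ r j → ρ (residue r j) ≡ r
  ρ-residue r j = trans (ℤp.[]-cong (trans
      (cong (_% p) (trans (toℕ-residue r j)
        (trans (ℕ.+-comm (p * toℕ j) (toℕ r)) (cong (λ m → toℕ r + m) (ℕ.*-comm p (toℕ j))))))
      (ℕ.[m+kn]%n≡m%n (toℕ r) (toℕ j) p)))
    (ℤp.[]-toℕ r)

  residue-injective : ∀ {r i j} → residue r i ≡ residue r j → i ≡ j
  residue-injective {r} {i} {j} eq = Fin.combine-injectiveˡ i r j r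
    (Fin.toℕ-injective (trans (sym (Fin.toℕ-cast _ (combine i r)))
      (trans (cong toℕ eq) (Fin.toℕ-cast _ (combine j r)))))

  residue-surjective : ∀ x → ∃ λ j → x ≡ residue (ρ x) j
  residue-surjective x
    with j , r , eq ← Fin.combine-surjective {q} {p} (cast (ℕ.*-comm p q) x) =
    j , trans x≡ (cong (λ r → residue r j) (sym (trans (cong ρ x≡) (ρ-residue r j))))
    where
    x≡ : x ≡ residue r j
    x≡ = Fin.toℕ-injective (trans (sym (Fin.toℕ-cast _ x))
      (trans (cong toℕ (sym eq)) (sym (Fin.toℕ-cast _ (combine j r)))))

  module Listing (C : Fin p → Pred (Fin (p * q)) 0ℓ) (listing : IsCosetListing p q C) where
    open IsCosetListing listing

    class : Fin (p * q) → Fin p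
    class x = proj₁ (exhausts x)

    rep : Fin p → Fin (p * q)
    rep r = proj₁ (isCoset r)

    C-class : ∀ x → C (class x) x
    C-class x = proj₂ (proj₂ (exhausts x)) (from (coset⇔ρ≡ x x) refl)

    C⇔ρ≡ : ∀ r x → C r x ⇔ ρ x ≡ ρ (rep r)
    C⇔ρ≡ r x = mk⇔
      (to (coset⇔ρ≡ (rep r) x) ∘ proj₁ (proj₂ (isCoset r)))
      (proj₂ (proj₂ (isCoset r)) ∘ from (coset⇔ρ≡ (rep r) x))

    -- Two listed cosets sharing `x` have representatives with equal residues, so they coincide and
    -- the listing gives them the same index.
    C⇒class≡ : ∀ {r x} → C r x → class x ≡ r
    C⇒class≡ {r} {x} Crx = injective (class x) r
      ( (λ {y} Cy → from (C⇔ρ≡ r y) (trans (to (C⇔ρ≡ _ y) Cy) ρrep≡))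
      , (λ {y} Cy → from (C⇔ρ≡ _ y) (trans (to (C⇔ρ≡ r y) Cy) (sym ρrep≡))))
      where
      ρrep≡ : ρ (rep (class x)) ≡ ρ (rep r)
      ρrep≡ = trans (sym (to (C⇔ρ≡ (class x) x) (C-class x))) (to (C⇔ρ≡ r x) Crx)

    class≡⇔ρ≡ : ∀ r x → class x ≡ r ⇔ ρ x ≡ ρ (rep r)
    class≡⇔ρ≡ r x = mk⇔
      (λ { refl → to (C⇔ρ≡ (class x) x) (C-class x) })
      (C⇒class≡ ∘ from (C⇔ρ≡ r x))

    class≡⇔ρ≡ρ : ∀ x y → class x ≡ class y ⇔ ρ x ≡ ρ y
    class≡⇔ρ≡ρ x y = mk⇔
      (λ eq → trans (to (class≡⇔ρ≡ _ x) eq) ρrep≡ρ)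
      (λ eq → from (class≡⇔ρ≡ _ x) (trans eq (sym ρrep≡ρ)))
      where
      ρrep≡ρ : ρ (rep (class y)) ≡ ρ y
      ρrep≡ρ = sym (to (class≡⇔ρ≡ _ y) refl)

-- The graph F

module Construction
  (p q : ℕ) .{{_ : NonZero p}} .{{_ : NonZero q}} (p-prime : Prime p) (odd : ¬ (2 ∣ p))
  (a : Fin (p * q))
  (generates : GeneratesUnits (ℤ/ p) (toℕ a mod p))
  (half : _^_ (RawRing.rawSemiring (ℤ/pq p q)) a ((p ∸ 1) / 2)
          ≡ RawRing.-_ (ℤ/pq p q) (RawRing.1# (ℤ/pq p q)))
  {t : ℕ} (tq≡2+l : t * q ≡ 2 + ∣S∩S+1∣ p q a)
  (C : Fin p → Pred (Fin (p * q)) 0ℓ) (listing : IsCosetListing p q C)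
  (π : Fin (t ∸ 1) → Permutation′ p)
  where

  open ConnectionSet p q p-prime odd a generates half
  open Cosets p q
  open Listing C listing

  private
    V : Set
    V = Fin t × Fin (p * q)

    σ : Fin t → Permutation′ p
    σ = withId p q {t} π

    -- F glues two cosets when `πᵢ⁻¹` and `πⱼ⁻¹` send their indices to the same value, so this value
    -- names the clique.
    clique : V → Fin p
    clique (i , x) = σ i ⟨$⟩ˡ class x

    _~_ : Rel V 0ℓ
    (i , x) ~ (j , y) = i ≡ j × Γ p q a x y

    clique≡⇔class≡ : ∀ i x κ → clique (i , x) ≡ κ ⇔ class x ≡ σ i ⟨$⟩ʳ κ
    clique≡⇔class≡ i x κ = mk⇔
      (λ { refl → sym (inverseʳ (σ i)) })
      (λ eq → trans (cong (σ i ⟨$⟩ˡ_) eq) (inverseˡ (σ i)))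

    clique≡⇒ρ≡ : ∀ i {x y} → clique (i , x) ≡ clique (i , y) → ρ x ≡ ρ y
    clique≡⇒ρ≡ i {x} {y} eq = to (class≡⇔ρ≡ρ x y)
      (trans (to (clique≡⇔class≡ i x _) eq) (inverseʳ (σ i)))

    -- Each vertex lies in one coset only, so the indices quantified in `F` must be the classes of
    -- the two ends.
    F⇔ : ∀ u v → F p q {t} C π a u v ⇔ (u ≢ v × (u ~ v ⊎ clique u ≡ clique v))
    F⇔ (i , x) (j , y) = mk⇔
      (λ (u≢v , adj) → u≢v , Sum.map₂
        (λ (k , l , Ckx , Cly , eq) → trans (cong (σ i ⟨$⟩ˡ_) (C⇒class≡ Ckx))
          (trans eq (cong (σ j ⟨$⟩ˡ_) (sym (C⇒class≡ Cly))))) adj)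
      (λ (u≢v , adj) → u≢v , Sum.map₂
        (λ eq → class x , class y , C-class x , C-class y , eq) adj)

    match : ∀ u κ → clique u ≢ κ → ∃ λ v → clique v ≡ κ × u ~ v
    match (i , x) κ ≢κ =
      -- The clique `κ` meets copy `i` in the coset with index `πᵢ(κ)`.
      let r = σ i ⟨$⟩ʳ κ
          y , ρy≡ , Sxy = Γ-matching x (ρ (rep r))
            (≢κ ∘ from (clique≡⇔class≡ i x κ) ∘ from (class≡⇔ρ≡ r x))
      in (i , y) , from (clique≡⇔class≡ i y κ) (from (class≡⇔ρ≡ r y) ρy≡) , refl , Sxy

    ~-edgeRegular : ∀ {u v} → u ~ v → HasCard (λ w → u ~ w × v ~ w) (∣S∩S+1∣ p q a)
    ~-edgeRegular {i , x} {_ , y} (refl , Sxy) = hasCard-⇔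
      (λ _ → mk⇔
        (λ { (z , (Sxz , Syz) , refl) → (refl , Sxz) , (refl , Syz) })
        (λ { ((refl , Sxz) , (_ , Syz)) → _ , (Sxz , Syz) , refl }))
      (hasCard-map (i ,_) ,-injectiveʳ (Γ-edgeRegular Sxy))

    -- A clique consists of one coset of `q` elements from each of the `t` copies.
    clique-card : ∀ κ → HasCard (λ v → clique v ≡ κ) (2 + ∣S∩S+1∣ p q a)
    clique-card κ = subst (HasCard _) tq≡2+l (hasCard-⇔
      (λ (i , x) → mk⇔
        (λ { ((i , j) , _ , refl) → from (clique≡⇔class≡ i _ κ)
          (from (class≡⇔ρ≡ _ _) (ρ-residue (base i) j)) })
        (λ eq → let j , x≡ = residue-surjective x in
          (i , j) , tt , cong (i ,_) (trans x≡
            (cong (λ r → residue r j) (to (class≡⇔ρ≡ _ x) (to (clique≡⇔class≡ i x κ) eq))))))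
      (hasCard-map (λ (i , j) → i , residue (base i) j) injective hasCard-Fin×Fin))
      where
      base : Fin t → Fin p
      base i = ρ (rep (σ i ⟨$⟩ʳ κ))
      injective : Injective _≡_ _≡_ (λ (i , j) → i , residue (base i) j)
      -- The residue class depends on the copy, so the copies are identified before the positions
      -- inside the coset are compared.
      injective {i , j} {i′ , j′} eq with refl ← i ≡ i′ ∋ ,-injectiveˡ eq =
        cong (i ,_) (residue-injective (,-injectiveʳ eq))

    distinctCliques : ∃₂ λ (κ₀ κ₁ : Fin p) → κ₀ ≢ κ₁
    distinctCliques = fromℕ< 0<p , fromℕ< 1<p , λ eq → ℕ.0≢1+n
      (trans (sym (Fin.toℕ-fromℕ< 0<p)) (trans (cong toℕ eq) (Fin.toℕ-fromℕ< 1<p)))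
      where
      1<p = ℕ.nonTrivial⇒n>1 p {{prime⇒nonTrivial p-prime}}
      0<p = ℕ.<-trans (s≤s z≤n) 1<p

  F-isNeumaier : let l = ∣S∩S+1∣ p q a in
                 IsNeumaier (F p q {t} C π a) (t * (p * q)) (p + l) l 1 (2 + l)
  F-isNeumaier = isNeumaier clique F⇔
    (λ (i≡j , Sxy) → sym i≡j , S-sym Sxy)
    (λ { {i , _} (refl , Sxy) → Γ⇒ρ≢ Sxy ∘ clique≡⇒ρ≡ i })
    match
    (λ { {i , _} (refl , Sxy) (refl , Sxz) eq →
      cong (i ,_) (Γ-matching-unique Sxy Sxz (clique≡⇒ρ≡ i eq)) })
    ~-edgeRegular clique-card hasCard-Fin×Fin (proj₂ (proj₂ distinctCliques))

mainTheorem6 : (p q : ℕ) .{{_ : NonZero p}} .{{_ : NonZero q}} →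
    Prime p → Prime q → ¬ (2 ∣ p) → ¬ (2 ∣ q) → p ≢ q →
    (a : Fin (p * q)) →
    let module R = RawRing (ℤ/pq p q) in
    IsUnit (ℤ/pq p q) a →
    GeneratesUnits (ℤ/ p) (toℕ a mod p) →
    _^_ R.rawSemiring a ((p ∸ 1) / 2) ≡ R.- R.1# →
    let l = ∣S∩S+1∣ p q a
        t = (l + 2) / q
    in
    (+ l) ≡ (- (+ 2)) [mod q ] →
    (C : Fin p → Pred (Fin (p * q)) 0ℓ) → IsCosetListing p q C →
    (π : Fin (t ∸ 1) → Permutation′ p) →
    IsNeumaier (F p q {t} C π a) (t * p * q) (p + l) l 1 (l + 2)
mainTheorem6 p q p-prime _ p-odd _ _ a _ generates half q∣l+2 C listing π =
  subst₂ (λ v s → IsNeumaier (F p q {t} C π a) v (p + l) l 1 s)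
    (sym (ℕ.*-assoc t p q)) (ℕ.+-comm 2 l)
    (Construction.F-isNeumaier p q p-prime p-odd a generates half {t}
      -- The congruence unfolds to `q` dividing `l + 2` in ℕ, so the quotient `t` is exact.
      (trans (ℕ.m/n*n≡m {l + 2} q∣l+2) (ℕ.+-comm l 2)) C listing π)
  where
  l = ∣S∩S+1∣ p q a
  t = (l + 2) / q
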